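{- The metric dimension of the game graph $G=G(K(1,n))$ of two opposing kings on a $1\times n$ strip is $$\beta(G)=\begin{cases} 2 & \text{if } 2\leq n\leq 3,\\ 3 & \text{if } n>3.\end{cases}$$
   Context: Two opposing kings, $K$ and $k$, are placed on a $1\times n$ strip with squares $1,\dots,n$. The positions are: $K_ik_j$ with $1\le i,j\le n$, $i\neq j$ (king $K$ on square $i$ and king $k$ on square $j$); $K_i$ with $1\le i\le n$ (only $K$ remains, on square $i$); and $k_j$ with $1\le j\le n$ (only $k$ remains, on square $j$). A move takes any one king present on the strip from its square to an adjacent square of the strip; if that square is occupied by the opposing king, the opposing king is captured and removed. Kings may move to squares adjacent to the opposing king, and a lone king may continue to move. Moves of both players are available at every position. The game graph $G(K(1,n))$ is the digraph whose vertices are all of these positions, with an arc from a position $p$ to a position $q$ whenever there is a legal move from $p$ to $q$. (Explicitly: $K_ik_j\to K_{i'}k_j$ if $|i-i'|=1$, $i'\ne j$; $K_ik_j\to K_ik_{j'}$ if $|j-j'|=1$, $j'\neq i$; $K_ik_j\to K_j$ and $K_ik_j\to k_i$ if $|i-j|=1$; $K_i\to K_{i'}$ and $k_i\to k_{i'}$ if $|i-i'|=1$.) Signed distance: in a digraph, let $d(u,v)$ be the number of arcs in a shortest directed path from $u$ to $v$ ($\infty$ if there is none, $d(u,u)=0$). The signed distance is $$d_{\pm}(u,v)=\begin{cases} d(u,v) & \text{if there is a directed } uv\text{ -path and } d(u,v)\le d(v,u),\\ -d(v,u) & \text{if there is a directed } vu\text{ -path and } d(v,u)<d(u,v),\\ \infty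 & \text{if there is neither a directed } uv\text{ -path nor a directed } vu\text{ -path.}\end{cases}$$ Metric dimension: for an ordered set $S=(u_1,\dots,u_k)$ of vertices, the distance vector of a vertex $v$ is $(d_\pm(u_1,v),\dots,d_\pm(u_k,v))$. $S$ is a resolving set if distinct vertices of the graph have distinct distance vectors. The metric dimension $\beta(G)$ is the minimum cardinality of a resolving set. -}

module Defs where

open import Data.Fin using (Fin; toℕ)
open import Data.Integer using (ℤ; +_; -_)
open import Data.Nat using (ℕ; zero; suc; _≤_; _<_; ∣_-_∣)
open import Data.Product using (_×_; ∃; ∃-syntax)
open import Data.Vec using (Vec)
open import Data.Vec.Relation.Binary.Pointwise.Inductive using (Pointwise)
open import Data.Vec.Relation.Unary.Unique.Propositional using (Unique)
open import Relation.Binary.Core using (Rel)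
open import Relation.Binary.Construct.Add.Supremum.NonStrict _≤_ using (_≤⁺_)
open import Relation.Binary.Construct.Add.Supremum.Strict _<_ using (_<⁺_)
open import Relation.Binary.PropositionalEquality using (_≡_; _≢_)
open import Relation.Nullary using (¬_)
open import Relation.Nullary.Construct.Add.Supremum using (_⁺; [_])
  renaming (⊤⁺ to ∞)
open import Level using (0ℓ)

IsLeast : (ℕ → Set) → ℕ → Set
IsLeast P k = P k × (∀ m → P m → k ≤ m)

record Digraph : Set₁ where
  infix 4 _⟶_
  field
    Vertex : Set
    _⟶_    : Rel Vertex 0ℓ

module _ (G : Digraph) where
  open Digraph G

  -- Vertices may repeat; this does not affect distances, since a walk of
  -- minimum length never repeats a vertex.
  data Walk : Vertex → Vertex → ℕ → Set where
    nil  : ∀ {u} → Walk u u zero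
    cons : ∀ {u v w k} → u ⟶ v → Walk v w k → Walk u w (suc k)

  -- Distances are given by their graphs, as relations: for an arbitrary
  -- digraph there is no function computing them.
  data IsDistance (u v : Vertex) : ℕ ⁺ → Set where
    finite   : ∀ {k} → IsLeast (Walk u v) k → IsDistance u v [ k ]
    infinite : (∀ k → ¬ Walk u v k) → IsDistance u v ∞

  data IsSignedDistance (u v : Vertex) : ℤ ⁺ → Set where
    forward  : ∀ {a b} → IsDistance u v [ a ] → IsDistance v u b →
               [ a ] ≤⁺ b → IsSignedDistance u v [ + a ]
    backward : ∀ {a b} → IsDistance v u [ a ] → IsDistance u v b →
               [ a ] <⁺ b → IsSignedDistance u v [ - (+ a) ]
    neither  : IsDistance u v ∞ → IsDistance v u ∞ →
               IsSignedDistance u v ∞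

  IsDistanceVector : ∀ {k} → Vec Vertex k → Vertex → Vec (ℤ ⁺) k → Set
  IsDistanceVector S v xs = Pointwise (λ u x → IsSignedDistance u v x) S xs

  -- A vertex has at most one distance vector, and in a finite digraph with
  -- decidable arcs it has exactly one. The existential form keeps the
  -- property from holding vacuously when there is none.
  IsResolving : ∀ {k} → Vec Vertex k → Set
  IsResolving S = ∀ v w → v ≢ w →
    ∃[ xs ] ∃[ ys ] IsDistanceVector S v xs × IsDistanceVector S w ys × xs ≢ ys

  IsMetricDimension : ℕ → Set
  IsMetricDimension =
    IsLeast (λ k → ∃ λ (S : Vec Vertex k) → Unique S × IsResolving S)

-- The squares 1, …, n are represented by Fin n, numbered from 0.
Adjacent : ∀ {n} → Rel (Fin n) 0ℓ
Adjacent i j = ∣ toℕ i - toℕ j ∣ ≡ 1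

-- The disequality is irrelevant, so a position with two kings is determined
-- by their squares.
data Position (n : ℕ) : Set where
  Kk : (i j : Fin n) → .(i ≢ j) → Position n
  K  : Fin n → Position n
  k  : Fin n → Position n

data Move {n : ℕ} : Rel (Position n) 0ℓ where
  K-moves    : ∀ {i i′ j} .(i≢j : i ≢ j) .(i′≢j : i′ ≢ j) → Adjacent i i′ →
               Move (Kk i j i≢j) (Kk i′ j i′≢j)
  k-moves    : ∀ {i j j′} .(i≢j : i ≢ j) .(i≢j′ : i ≢ j′) → Adjacent j j′ →
               Move (Kk i j i≢j) (Kk i j′ i≢j′)
  K-captures : ∀ {i j} .(i≢j : i ≢ j) → Adjacent i j → Move (Kk i j i≢j) (K j)
  k-captures : ∀ {i j} .(i≢j : i ≢ j) → Adjacent i j → Move (Kk i j i≢j) (k i)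
  K-alone    : ∀ {i i′} → Adjacent i i′ → Move (K i) (K i′)
  k-alone    : ∀ {i i′} → Adjacent i i′ → Move (k i) (k i′)

kingsGraph : ℕ → Digraph
kingsGraph n = record { Vertex = Position n ; _⟶_ = Move }

{-# OPTIONS --safe #-}

-- Call a position with both kings left if K is left of k, and right otherwise;
-- no walk joins a left and a right position. With squares counted from 0,
-- the distance to K 0 is j + 1 from a left position Kk i j (k walks towards K,
-- is captured next to K's square, and K returns) and i from a right one;
-- for k 0 and k (n − 1), exchange the kings or reverse the strip.
-- Hence K 0 and k (n − 1) separate all positions except a left Kk i j from the
-- right Kk (j + 1) (i − 1), which requires i − 1 < i < j < j + 1 and so n > 3;
-- k 0 separates these as well. Two vertices never suffice for n > 3: the kind
-- of position that only one of them, or neither, reaches at finite distance is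
-- then too large, unless the vertices are K and k at ends of the strip, where
-- the explicit distances collide.
module Submission where

open import Defs
open import Data.Empty using (⊥; ⊥-elim-irr)
open import Data.Fin using (Fin; zero; suc; toℕ; fromℕ; inject₁; opposite)
  renaming (_<_ to _<ᶠ_; _<?_ to _<ᶠ?_)
open import Data.Fin.Patterns using (0F; 1F; 2F; 3F)
open import Data.Fin.Properties using (toℕ-injective; toℕ-inject₁; toℕ<n; opposite-prop; opposite-involutive)
  renaming (<-cmp to <ᶠ-cmp; <⇒≢ to <⇒≢ᶠ)
open import Data.Fin.Relation.Unary.Top using (view; ‵fromℕ; ‵inject₁)
open import Data.Integer using (ℤ; +_; -_)
open import Data.Integer.Properties using (neg-injective) renaming (+-injective to +ᶻ-injective)
open import Data.Nat using (ℕ; zero; suc; _+_; _≤_; _<_; _>_; z≤n; s≤s; s≤s⁻¹; z<s; ∣_-_∣)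
open import Data.Nat.Properties
open import Data.Product using (_×_; _,_; ∃-syntax)
open import Data.Sum using (_⊎_; inj₁; inj₂; [_,_]′)
open import Data.Vec using (Vec; []; _∷_; head; tail)
open import Data.Vec.Relation.Binary.Pointwise.Inductive using ([]; _∷_)
open import Data.Vec.Relation.Unary.All using (All; []; _∷_)
open import Data.Vec.Relation.Unary.AllPairs using ([]; _∷_)
open import Function using (_∘_)
open import Relation.Binary.Construct.Add.Supremum.NonStrict _≤_ using ([_]; _≤⊤⁺; [≤]-injective)
open import Relation.Binary.Construct.Add.Supremum.Strict _<_ using ([_]<⊤⁺; [<]-injective)
open import Relation.Binary.Definitions using (tri<; tri≈; tri>)
open import Relation.Binary.PropositionalEquality using (_≡_; _≢_; refl; sym; trans; cong; cong₂; subst; subst₂; ≢-sym)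
open import Relation.Nullary using (¬_; yes; no; contradiction)
open import Relation.Nullary.Construct.Add.Supremum using (_⁺; [_]; []-injective) renaming (⊤⁺ to ∞)

-- Signed distances in digraphs

module _ {G : Digraph} where
  open Digraph G

  snoc : ∀ {u v w ℓ} → Walk G u v ℓ → v ⟶ w → Walk G u w (suc ℓ)
  snoc nil a        = cons a nil
  snoc (cons b p) a = cons b (snoc p a)

  walk-++ : ∀ {u v w ℓ ℓ′} → Walk G u v ℓ → Walk G v w ℓ′ → Walk G u w (ℓ + ℓ′)
  walk-++ nil        q = q
  walk-++ (cons a p) q = cons a (walk-++ p q)

  walk-length : ∀ {u v ℓ ℓ′} → ℓ ≡ ℓ′ → Walk G u v ℓ → Walk G u v ℓ′
  walk-length refl p = p

  distance-unique : ∀ {u v x y} → IsDistance G u v x → IsDistance G u v y → x ≡ y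
  distance-unique (finite (p , p-min)) (finite (q , q-min)) = cong [_] (≤-antisym (p-min _ q) (q-min _ p))
  distance-unique (finite (p , _)) (infinite none) = contradiction p (none _)
  distance-unique (infinite none) (finite (p , _)) = contradiction p (none _)
  distance-unique (infinite _) (infinite _) = refl

  signedDistance-unique : ∀ {u v x y} → IsSignedDistance G u v x → IsSignedDistance G u v y → x ≡ y
  signedDistance-unique (forward d _ _) (forward d′ _ _) =
    cong (λ { [ a ] → [ + a ] ; ∞ → ∞ }) (distance-unique d d′)
  signedDistance-unique (forward d e a≤b) (backward e′ d′ b<a)
    with refl ← distance-unique d d′ | refl ← distance-unique e e′ =
      contradiction ([≤]-injective a≤b) (<⇒≱ ([<]-injective b<a))
  signedDistance-unique (forward d _ _) (neither d′ _) with () ← distance-unique d d′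
  signedDistance-unique (backward e d b<a) (forward d′ e′ a≤b)
    with refl ← distance-unique d d′ | refl ← distance-unique e e′ =
      contradiction ([≤]-injective a≤b) (<⇒≱ ([<]-injective b<a))
  signedDistance-unique (backward e _ _) (backward e′ _ _) =
    cong (λ { [ a ] → [ - (+ a) ] ; ∞ → ∞ }) (distance-unique e e′)
  signedDistance-unique (backward e _ _) (neither _ e′) with () ← distance-unique e e′
  signedDistance-unique (neither d _) (forward d′ _ _) with () ← distance-unique d d′
  signedDistance-unique (neither _ e) (backward e′ _ _) with () ← distance-unique e e′
  signedDistance-unique (neither _ _) (neither _ _) = refl

  distance-one : ∀ {u v} → u ≢ v → u ⟶ v → IsDistance G u v [ 1 ]
  distance-one u≢v a = finite (cons a nil , λ { zero nil → contradiction refl u≢v ; (suc _) _ → s≤s z≤n })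

  distance-two : ∀ {u v w} → u ≢ w → ¬ (u ⟶ w) → u ⟶ v → v ⟶ w → IsDistance G u w [ 2 ]
  distance-two u≢w ¬a a b = finite (cons a (cons b nil) , λ
    { zero nil → contradiction refl u≢w
    ; (suc zero) (cons c nil) → contradiction c ¬a
    ; (suc (suc _)) _ → s≤s (s≤s z≤n) })

  signedDistance-symmetric : ∀ {u v a} → IsDistance G u v [ a ] → IsDistance G v u [ a ] →
    IsSignedDistance G u v [ + a ]
  signedDistance-symmetric d e = forward d e [ ≤-refl ]

  neighbour : ∀ {u v} → u ≢ v → u ⟶ v → v ⟶ u → IsSignedDistance G u v [ + 1 ]
  neighbour u≢v a b = signedDistance-symmetric (distance-one u≢v a) (distance-one (≢-sym u≢v) b)

  -- A common value is exhibited instead of equating two values, because signed distances are given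
  -- as a relation.
  Confuses : Vertex → Vertex → Vertex → Set
  Confuses u v w = ∃[ x ] IsSignedDistance G u v x × IsSignedDistance G u w x

  -- One pair defeats both landmarks at once. The landmarks may coincide, so `Unresolved u u` rules
  -- out the single landmark `u`.
  Unresolved : Vertex → Vertex → Set
  Unresolved u u′ = ∃[ v ] ∃[ w ] v ≢ w × Confuses u v w × Confuses u′ v w

  unresolved-sym : ∀ {u u′} → Unresolved u u′ → Unresolved u′ u
  unresolved-sym (v , w , v≢w , c , c′) = v , w , v≢w , c′ , c

  confused-vectors : ∀ {m} {S : Vec Vertex m} {v w xs ys} → All (λ u → Confuses u v w) S →
    IsDistanceVector G S v xs → IsDistanceVector G S w ys → xs ≡ ys
  confused-vectors [] [] [] = refl
  confused-vectors ((_ , d , e) ∷ cs) (d′ ∷ ds) (e′ ∷ es) =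
    cong₂ _∷_ (trans (signedDistance-unique d′ d) (signedDistance-unique e e′)) (confused-vectors cs ds es)

  confused⇒¬resolving : ∀ {m} {S : Vec Vertex m} {v w} → v ≢ w → All (λ u → Confuses u v w) S → ¬ IsResolving G S
  confused⇒¬resolving v≢w cs res with _ , _ , ds , es , xs≢ys ← res _ _ v≢w =
    xs≢ys (confused-vectors cs ds es)

  unresolved⇒2≤ : Vertex → (∀ u → Unresolved u u) → ∀ {m} (S : Vec Vertex m) → IsResolving G S → 2 ≤ m
  -- For the empty list, `t` only serves to produce two distinct vertices.
  unresolved⇒2≤ t un [] res with _ , _ , v≢w , _ ← un t = contradiction res (confused⇒¬resolving v≢w [])
  unresolved⇒2≤ t un (u ∷ []) res with _ , _ , v≢w , c , _ ← un u =
    contradiction res (confused⇒¬resolving v≢w (c ∷ []))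
  unresolved⇒2≤ t un (_ ∷ _ ∷ _) res = s≤s (s≤s z≤n)

  unresolved⇒3≤ : Vertex → (∀ u u′ → Unresolved u u′) → ∀ {m} (S : Vec Vertex m) → IsResolving G S → 3 ≤ m
  unresolved⇒3≤ t un [] res = contradiction (unresolved⇒2≤ t (λ u → un u u) [] res) λ ()
  unresolved⇒3≤ t un (u ∷ []) res =
    contradiction (unresolved⇒2≤ t (λ u → un u u) (u ∷ []) res) λ { (s≤s ()) }
  unresolved⇒3≤ t un (u ∷ u′ ∷ []) res
    with _ , _ , v≢w , c , c′ ← un u u′ = contradiction res (confused⇒¬resolving v≢w (c ∷ c′ ∷ []))
  unresolved⇒3≤ t un (_ ∷ _ ∷ _ ∷ _) res = s≤s (s≤s (s≤s z≤n))

  injective⇒resolving : ∀ {m} {S : Vec Vertex m} (f : Vertex → Vec (ℤ ⁺) m) →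
    (∀ v → IsDistanceVector G S v (f v)) → (∀ {v w} → f v ≡ f w → v ≡ w) → IsResolving G S
  injective⇒resolving f f-vec f-inj v w v≢w = f v , f w , f-vec v , f-vec w , v≢w ∘ f-inj

-- Transport along involutive symmetries

walk-map : ∀ {G H : Digraph} (f : Digraph.Vertex G → Digraph.Vertex H) →
  (∀ {u v} → Digraph._⟶_ G u v → Digraph._⟶_ H (f u) (f v)) →
  ∀ {u v ℓ} → Walk G u v ℓ → Walk H (f u) (f v) ℓ
walk-map f f-mono nil        = nil
walk-map f f-mono (cons a p) = cons (f-mono a) (walk-map f f-mono p)

-- Preserving arcs is enough: applying `act` twice shows that arcs are reflected too, so `act` is an
-- automorphism.
record Involution (G : Digraph) : Set where
  open Digraph G
  field
    act        : Vertex → Vertex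
    involutive : ∀ u → act (act u) ≡ u
    monotone   : ∀ {u v} → u ⟶ v → act u ⟶ act v

module _ {G : Digraph} (φ : Involution G) where
  open Digraph G
  open Involution φ

  walk-push : ∀ {u v ℓ} → Walk G u v ℓ → Walk G (act u) (act v) ℓ
  walk-push = walk-map act monotone

  walk-pull : ∀ {u v ℓ} → Walk G (act u) (act v) ℓ → Walk G u v ℓ
  walk-pull p = subst₂ (λ u v → Walk G u v _) (involutive _) (involutive _) (walk-push p)

  distance-push : ∀ {u v x} → IsDistance G u v x → IsDistance G (act u) (act v) x
  distance-push (finite (p , p-min)) = finite (walk-push p , λ m q → p-min m (walk-pull q))
  distance-push (infinite none) = infinite λ m q → none m (walk-pull q)

  signedDistance-push : ∀ {u v x} → IsSignedDistance G u v x → IsSignedDistance G (act u) (act v) x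
  signedDistance-push (forward d e a≤b)  = forward (distance-push d) (distance-push e) a≤b
  signedDistance-push (backward d e a<b) = backward (distance-push d) (distance-push e) a<b
  signedDistance-push (neither d e)      = neither (distance-push d) (distance-push e)

  signedDistance-pull : ∀ {u v x} → IsSignedDistance G (act u) (act v) x → IsSignedDistance G u v x
  signedDistance-pull d =
    subst₂ (λ u v → IsSignedDistance G u v _) (involutive _) (involutive _) (signedDistance-push d)

  confuses-act : ∀ {u v w} → Confuses (act u) v w → Confuses u (act v) (act w)
  confuses-act (x , d , e) = x ,
    subst (λ u → IsSignedDistance G u _ x) (involutive _) (signedDistance-push d) ,
    subst (λ u → IsSignedDistance G u _ x) (involutive _) (signedDistance-push e)

  act-≢ : ∀ {v w} → v ≢ w → act v ≢ act w
  act-≢ v≢w e = v≢w (trans (sym (involutive _)) (trans (cong act e) (involutive _)))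

  unresolved-pull : ∀ {u u′} → Unresolved (act u) (act u′) → Unresolved u u′
  unresolved-pull (v , w , v≢w , c , c′) = act v , act w , act-≢ v≢w , confuses-act c , confuses-act c′

-- The strip and its reversal

adjacent-up : ∀ {n} {i j : Fin n} → toℕ j ≡ suc (toℕ i) → Adjacent i j
adjacent-up {i = i} e rewrite e = ∣n-1+n∣≡1 (toℕ i)
  where
  ∣n-1+n∣≡1 : ∀ n → ∣ n - suc n ∣ ≡ 1
  ∣n-1+n∣≡1 zero    = refl
  ∣n-1+n∣≡1 (suc n) = ∣n-1+n∣≡1 n

adjacent-irrefl : ∀ {n} (i : Fin n) → ¬ Adjacent i i
adjacent-irrefl i a = 0≢1+n (trans (sym (∣n-n∣≡0 (toℕ i))) a)

adjacent-sym : ∀ {n} {i j : Fin n} → Adjacent i j → Adjacent j i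
adjacent-sym {i = i} {j} a = trans (∣-∣-comm (toℕ j) (toℕ i)) a

∣-∣≡1 : ∀ a b → ∣ a - b ∣ ≡ 1 → b ≡ suc a ⊎ a ≡ suc b
∣-∣≡1 zero    b       e = inj₁ e
∣-∣≡1 (suc a) zero    e = inj₂ e
∣-∣≡1 (suc a) (suc b) e = [ inj₁ ∘ cong suc , inj₂ ∘ cong suc ]′ (∣-∣≡1 a b e)

adjacent-≤ : ∀ {n} {i j : Fin n} → Adjacent i j → toℕ i ≤ suc (toℕ j)
adjacent-≤ {i = i} {j} a with ∣-∣≡1 (toℕ i) (toℕ j) a
... | inj₁ e rewrite e = m≤n⇒m≤1+n (n≤1+n _)
... | inj₂ e = ≤-reflexive e

∣-∣-cons : ∀ {n m ℓ} {i i′ : Fin n} → Adjacent i i′ → ∣ toℕ i′ - m ∣ ≤ ℓ → ∣ toℕ i - m ∣ ≤ suc ℓ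
∣-∣-cons {m = m} {i = i} {i′} a p = ≤-trans (∣-∣-triangle (toℕ i) (toℕ i′) m) (+-mono-≤ (≤-reflexive a) p)

-- The additive form lets the following lemmas cancel a summand instead of handling truncated
-- subtraction.
opposite-+ : ∀ {n} (i : Fin n) → toℕ (opposite i) + suc (toℕ i) ≡ n
opposite-+ i rewrite opposite-prop i = m∸n+n≡m (toℕ<n i)

opposite-step : ∀ {n} {i j : Fin n} → toℕ j ≡ suc (toℕ i) → toℕ (opposite i) ≡ suc (toℕ (opposite j))
opposite-step {i = i} {j} e = +-cancelʳ-≡ (suc (toℕ i)) _ _
  (trans (opposite-+ i) (trans (sym (opposite-+ j)) (trans (cong (λ x → toℕ (opposite j) + suc x) e) (+-suc _ _))))

opposite-adjacent : ∀ {n} {i j : Fin n} → Adjacent i j → Adjacent (opposite i) (opposite j)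
opposite-adjacent {i = i} {j} a with ∣-∣≡1 (toℕ i) (toℕ j) a
... | inj₁ e = adjacent-sym {i = opposite j} {opposite i}
  (adjacent-up {i = opposite j} {opposite i} (opposite-step {i = i} {j} e))
... | inj₂ e = adjacent-up {i = opposite i} {opposite j} (opposite-step {i = j} {i} e)

opposite-injective : ∀ {n} {i j : Fin n} → opposite i ≡ opposite j → i ≡ j
opposite-injective e = trans (sym (opposite-involutive _)) (trans (cong opposite e) (opposite-involutive _))

opposite-< : ∀ {n} {i j : Fin n} → i <ᶠ j → opposite j <ᶠ opposite i
opposite-< {i = i} {j} i<j = +-cancelʳ-≤ (suc (toℕ i)) _ _ (begin
  suc (toℕ (opposite j)) + suc (toℕ i)  ≡⟨ +-suc _ (suc (toℕ i)) ⟨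
  toℕ (opposite j) + suc (suc (toℕ i))  ≤⟨ +-monoʳ-≤ (toℕ (opposite j)) (s≤s i<j) ⟩
  toℕ (opposite j) + suc (toℕ j)        ≡⟨ opposite-+ j ⟩
  _                                     ≡⟨ opposite-+ i ⟨
  toℕ (opposite i) + suc (toℕ i)        ∎)
  where open ≤-Reasoning

side : ∀ {n} (i j : Fin n) → .(i ≢ j) → i <ᶠ j ⊎ j <ᶠ i
side i j i≢j with <ᶠ-cmp i j
... | tri< i<j _ _ = inj₁ i<j
... | tri≈ _ i≡j _ = ⊥-elim-irr (i≢j i≡j)
... | tri> _ _ j<i = inj₂ j<i

-- To pass the other king without landing on its square, a king would have to advance at least two
-- squares.
<-stepˡ : ∀ {n} {i i′ j : Fin n} → .(i′ ≢ j) → Adjacent i i′ → i <ᶠ j → i′ <ᶠ j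
<-stepˡ {i = i} {i′} {j} i′≢j a i<j with side i′ j i′≢j
... | inj₁ i′<j = i′<j
... | inj₂ j<i′ =
  contradiction (adjacent-≤ {i = i′} {i} (adjacent-sym {i = i} {i′} a)) (<⇒≱ (≤-<-trans i<j j<i′))

<-stepʳ : ∀ {n} {i j j′ : Fin n} → .(i ≢ j′) → Adjacent j j′ → i <ᶠ j → i <ᶠ j′
<-stepʳ {i = i} {j} {j′} i≢j′ a i<j with side i j′ i≢j′
... | inj₁ i<j′ = i<j′
... | inj₂ j′<i = contradiction (adjacent-≤ {i = j} {j′} a) (<⇒≱ (≤-<-trans j′<i i<j))

strip : ℕ → Digraph
strip n = record { Vertex = Fin n ; _⟶_ = Adjacent }

strip-walk : ∀ {n} (i j : Fin n) → Walk (strip n) i j ∣ toℕ i - toℕ j ∣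
strip-walk zero          zero          = nil
strip-walk zero          (suc zero)    = cons refl nil
strip-walk zero          (suc (suc j)) = cons refl (walk-map suc (λ a → a) (strip-walk zero (suc j)))
strip-walk (suc zero)    zero          = cons refl nil
strip-walk (suc (suc i)) zero          = snoc (walk-map suc (λ a → a) (strip-walk (suc i) zero)) refl
strip-walk (suc i)       (suc j)       = walk-map suc (λ a → a) (strip-walk i j)

-- Symmetries of the game graph

Kk-cong : ∀ {n} {i i′ j j′ : Fin n} .{p : i ≢ j} .{q : i′ ≢ j′} → i ≡ i′ → j ≡ j′ → Kk i j p ≡ Kk i′ j′ q
Kk-cong refl refl = refl

swap : ∀ {n} → Involution (kingsGraph n)
swap {n} = record { act = act ; involutive = involutive ; monotone = monotone }
  where
  act : Position n → Position n
  act (Kk i j i≢j) = Kk j i (i≢j ∘ sym)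
  act (K i)        = k i
  act (k i)        = K i
  involutive : ∀ u → act (act u) ≡ u
  involutive (Kk _ _ _) = refl
  involutive (K _)      = refl
  involutive (k _)      = refl
  monotone : ∀ {u v} → Move u v → Move (act u) (act v)
  monotone (K-moves p q a)             = k-moves _ _ a
  monotone (k-moves p q a)             = K-moves _ _ a
  monotone (K-captures {i} {j} p a)    = k-captures _ (adjacent-sym {i = i} {j} a)
  monotone (k-captures {i} {j} p a)    = K-captures _ (adjacent-sym {i = i} {j} a)
  monotone (K-alone a)                 = k-alone a
  monotone (k-alone a)                 = K-alone a

reflect : ∀ {n} → Involution (kingsGraph n)
reflect {n} = record { act = act ; involutive = involutive ; monotone = monotone }
  where
  act : Position n → Position n
  act (Kk i j i≢j) = Kk (opposite i) (opposite j) (i≢j ∘ opposite-injective)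
  act (K i)        = K (opposite i)
  act (k i)        = k (opposite i)
  involutive : ∀ u → act (act u) ≡ u
  involutive (Kk i j _) = Kk-cong (opposite-involutive i) (opposite-involutive j)
  involutive (K i)      = cong K (opposite-involutive i)
  involutive (k i)      = cong k (opposite-involutive i)
  monotone : ∀ {u v} → Move u v → Move (act u) (act v)
  monotone (K-moves {i} {i′} p q a)    = K-moves _ _ (opposite-adjacent {i = i} {i′} a)
  monotone (k-moves {_} {j} {j′} p q a) = k-moves _ _ (opposite-adjacent {i = j} {j′} a)
  monotone (K-captures {i} {j} p a)    = K-captures _ (opposite-adjacent {i = i} {j} a)
  monotone (k-captures {i} {j} p a)    = k-captures _ (opposite-adjacent {i = i} {j} a)
  monotone (K-alone {i} {i′} a)        = K-alone (opposite-adjacent {i = i} {i′} a)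
  monotone (k-alone {i} {i′} a)        = k-alone (opposite-adjacent {i = i} {i′} a)

-- Embeds the game into a strip with a new square below all others; the walks to `K zero` are built
-- by induction along it.
shift : ∀ {n} → Position n → Position (suc n)
shift (Kk i j i≢j) = Kk (suc i) (suc j) (λ { refl → i≢j refl })
shift (K i)        = K (suc i)
shift (k i)        = k (suc i)

shift-walk : ∀ {n u v ℓ} → Walk (kingsGraph n) u v ℓ → Walk (kingsGraph (suc n)) (shift u) (shift v) ℓ
shift-walk = walk-map shift λ
  { (K-moves _ _ a) → K-moves _ _ a ; (k-moves _ _ a) → k-moves _ _ a
  ; (K-captures _ a) → K-captures _ a ; (k-captures _ a) → k-captures _ a
  ; (K-alone a) → K-alone a ; (k-alone a) → k-alone a }

-- Invariants of walks and lower bounds for their length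

module _ {n : ℕ} where
  open Involution

  GameWalk : Position n → Position n → ℕ → Set
  GameWalk = Walk (kingsGraph n)

  SD : Position n → Position n → ℤ ⁺ → Set
  SD = IsSignedDistance (kingsGraph n)

  Tied : Position n → Position n → Set
  Tied = Unresolved {kingsGraph n}

  K-not-to-k : ∀ {i j ℓ} → ¬ GameWalk (K i) (k j) ℓ
  K-not-to-k (cons (K-alone _) p) = K-not-to-k p

  K-not-to-Kk : ∀ {i a b ℓ} .{a≢b : a ≢ b} → ¬ GameWalk (K i) (Kk a b a≢b) ℓ
  K-not-to-Kk (cons (K-alone _) p) = K-not-to-Kk p

  k-not-to-K : ∀ {i j ℓ} → ¬ GameWalk (k i) (K j) ℓ
  k-not-to-K p = K-not-to-k (walk-push swap p)

  IsLeft IsRight : Position n → Set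
  IsLeft (Kk i j _) = i <ᶠ j
  IsLeft (K _)      = ⊥
  IsLeft (k _)      = ⊥
  IsRight u = IsLeft (act swap u)

  -- Non-capturing moves keep the order of the kings, and after a capture there is never a second
  -- king again.
  left-not-to-right : ∀ {u v ℓ} → IsLeft u → IsRight v → ¬ GameWalk u v ℓ
  left-not-to-right {Kk _ _ _} i<j j<i nil = <-asym i<j j<i
  left-not-to-right i<j r (cons (K-moves {i} {i′} {j} _ i′≢j a) p) =
    left-not-to-right (<-stepˡ {i = i} {i′} {j} i′≢j a i<j) r p
  left-not-to-right i<j r (cons (k-moves {i} {j} {j′} _ i≢j′ a) p) =
    left-not-to-right (<-stepʳ {i = i} {j} {j′} i≢j′ a i<j) r p
  left-not-to-right {v = Kk _ _ _} l r (cons (K-captures _ _) p) = K-not-to-Kk p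
  left-not-to-right {v = Kk _ _ _} l r (cons (k-captures _ _) p) = K-not-to-Kk (walk-push swap p)

  right-not-to-left : ∀ {u v ℓ} → IsRight u → IsLeft v → ¬ GameWalk u v ℓ
  right-not-to-left {v = Kk _ _ _} r l p = left-not-to-right r l (walk-push swap p)

  left-right : ∀ {u v} → IsLeft u → IsRight v → SD u v ∞
  left-right l r = neither (infinite λ _ → left-not-to-right l r) (infinite λ _ → right-not-to-left r l)

  right-left : ∀ {u v} → IsRight u → IsLeft v → SD u v ∞
  right-left r l = neither (infinite λ _ → right-not-to-left r l) (infinite λ _ → left-not-to-right l r)

  K-k : ∀ {i j} → SD (K i) (k j) ∞
  K-k = neither (infinite λ _ → K-not-to-k) (infinite λ _ → k-not-to-K)

  k-K : ∀ {i j} → SD (k i) (K j) ∞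
  k-K = neither (infinite λ _ → k-not-to-K) (infinite λ _ → K-not-to-k)

  K-displacement : ∀ {i m ℓ} → GameWalk (K i) (K m) ℓ → ∣ toℕ i - toℕ m ∣ ≤ ℓ
  K-displacement {i} nil = ≤-reflexive (∣n-n∣≡0 (toℕ i))
  K-displacement (cons (K-alone {i} {i′} a) p) = ∣-∣-cons {i = i} {i′} a (K-displacement p)

  -- K survives the whole walk, as it ends at a lone `K`. Each move brings K at most one square
  -- closer to `m`, and moves of k do not bring it closer at all.
  displacement : ∀ {i j m ℓ} .{i≢j : i ≢ j} → GameWalk (Kk i j i≢j) (K m) ℓ → ∣ toℕ i - toℕ m ∣ ≤ ℓ
  displacement (cons (K-moves {i} {i′} _ _ a) p)  = ∣-∣-cons {i = i} {i′} a (displacement p)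
  displacement (cons (k-moves _ _ _) p)           = m≤n⇒m≤1+n (displacement p)
  displacement (cons (K-captures {i} {i′} _ a) p) = ∣-∣-cons {i = i} {i′} a (K-displacement p)
  displacement (cons (k-captures _ _) p)          = contradiction p k-not-to-K

  -- k moves from j to the square c of its capture, K from some square left
  -- of c to c and on to m: at least (j ∸ c) + 1 + (c ∸ m) moves.
  left-capture : ∀ {i j m ℓ} .{i≢j : i ≢ j} → i <ᶠ j → GameWalk (Kk i j i≢j) (K m) ℓ → toℕ j < toℕ m + ℓ
  left-capture {m = m} {suc ℓ} i<j (cons (K-moves {i} {i′} {j} _ i′≢j a) p) =
    <-≤-trans (left-capture (<-stepˡ {i = i} {i′} {j} i′≢j a i<j) p) (+-monoʳ-≤ (toℕ m) (n≤1+n ℓ))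
  left-capture {m = m} {suc ℓ} i<j (cons (k-moves {i} {j} {j′} _ i≢j′ a) p) =
    subst (toℕ j <_) (sym (+-suc (toℕ m) ℓ))
      (s≤s (≤-trans (adjacent-≤ {i = j} {j′} a) (left-capture (<-stepʳ {i = i} {j} {j′} i≢j′ a i<j) p)))
  left-capture {m = m} {suc ℓ} i<j (cons (K-captures {j = j} _ _) p) =
    subst (toℕ j <_) (sym (+-suc (toℕ m) ℓ))
      (s≤s (≤-trans (m≤n+∣m-n∣ (toℕ j) (toℕ m)) (+-monoʳ-≤ (toℕ m) (K-displacement p))))
  left-capture i<j (cons (k-captures _ _) p) = contradiction p k-not-to-K

  K-walk : ∀ i m → GameWalk (K i) (K m) ∣ toℕ i - toℕ m ∣
  K-walk i m = walk-map K K-alone (strip-walk i m)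

  backward-from-K : ∀ {m a b d} .{a≢b : a ≢ b} →
    IsDistance (kingsGraph n) (Kk a b a≢b) (K m) [ d ] →
    SD (K m) (Kk a b a≢b) [ - (+ d) ]
  backward-from-K d = backward d (infinite λ _ → K-not-to-Kk) [ _ ]<⊤⁺

-- Walks that attain the bounds

left-walk : ∀ {n} (i j : Fin (suc n)) .(i≢j : i ≢ j) → i <ᶠ j →
  Walk (kingsGraph (suc n)) (Kk i j i≢j) (K zero) (suc (toℕ j))
left-walk zero (suc zero) _ _ = cons (K-captures _ refl) (cons (K-alone refl) nil)
-- The strip walk is read one square higher, so that k stays off K's square 0 and stops on square 1,
-- where it is captured.
left-walk {suc n} zero (suc (suc j)) _ _ =
  walk-length (+-comm (suc (toℕ j)) 2)
    (walk-++ (walk-map (λ i → Kk zero (suc i) λ ()) (λ {i} {i′} a → k-moves {j = suc i} {suc i′} _ _ a)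
                       (strip-walk (suc j) zero))
             (left-walk zero (suc zero) _ z<s))
-- With square 0 empty, the game is played on the strip above it and ends with K on square 1; one
-- more move brings K home.
left-walk {suc n} (suc i) (suc j) i≢j (s≤s i<j) =
  snoc (shift-walk (left-walk i j (i≢j ∘ cong suc) i<j)) (K-alone refl)

right-walk : ∀ {n} (i j : Fin (suc n)) .(i≢j : i ≢ j) → j <ᶠ i →
  Walk (kingsGraph (suc n)) (Kk i j i≢j) (K zero) (toℕ i)
-- K walks down to square 1, next to k, and its last move captures on square 0.
right-walk {suc n} (suc i) zero _ _ =
  snoc (walk-length (∣-∣-identityʳ (toℕ i))
         (walk-map (λ i → Kk (suc i) zero λ ()) (λ {i} {i′} a → K-moves {i = suc i} {suc i′} _ _ a)
                   (strip-walk i zero)))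
       (K-captures _ refl)
right-walk {suc n} (suc i) (suc j) i≢j (s≤s j<i) =
  snoc (shift-walk (right-walk i j (i≢j ∘ cong suc) j<i)) (K-alone refl)

-- Signed distances from the ends of the strip

-- The distance from `Kk i j` to `K zero`. The second branch also gives a value at `i ≡ j`, which no
-- position realises.
depth : ∀ {n} → Fin n → Fin n → ℕ
depth i j with i <ᶠ? j
... | yes _ = suc (toℕ j)
... | no _  = toℕ i

depth-left : ∀ {n} {i j : Fin n} → i <ᶠ j → depth i j ≡ suc (toℕ j)
depth-left {i = i} {j} i<j with i <ᶠ? j
... | yes _  = refl
... | no i≮j = contradiction i<j i≮j

depth-right : ∀ {n} {i j : Fin n} → j <ᶠ i → depth i j ≡ toℕ i
depth-right {i = i} {j} j<i with i <ᶠ? j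
... | yes i<j = contradiction i<j (<-asym j<i)
... | no _    = refl

-- Since `- (+ 0)` is `+ 0`, positivity is what tells the code of a two-king position from that of a
-- lone `K`.
0<depth : ∀ {n} {i j : Fin n} → .(i ≢ j) → 0 < depth i j
0<depth {i = i} {j} i≢j with side i j i≢j
... | inj₁ i<j rewrite depth-left {i = i} {j} i<j = z<s
... | inj₂ j<i rewrite depth-right {i = i} {j} j<i = ≤-<-trans z≤n j<i

-- The signed distance from `K zero`: negative with two kings, because a lone K can be reached from
-- there but cannot return.
code : ∀ {n} → Position n → ℤ ⁺
code (Kk i j _) = [ - (+ depth i j) ]
code (K i)      = [ + toℕ i ]
code (k _)      = ∞

signedDistance-K₀ : ∀ {n} (v : Position (suc n)) → SD (K zero) v (code v)
signedDistance-K₀ (Kk i j i≢j) with side i j i≢j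
... | inj₁ i<j rewrite depth-left {i = i} {j} i<j =
  backward-from-K (finite (left-walk i j i≢j i<j , λ _ → left-capture i<j))
... | inj₂ j<i rewrite depth-right {i = i} {j} j<i =
  backward-from-K (finite (right-walk i j i≢j j<i , λ _ p → subst (_≤ _) (∣-∣-identityʳ (toℕ i)) (displacement p)))
signedDistance-K₀ (K i) = signedDistance-symmetric
  (finite (K-walk zero i , λ _ → K-displacement))
  (finite (walk-length (∣-∣-identityʳ (toℕ i)) (K-walk i zero) ,
   λ _ p → subst (_≤ _) (∣-∣-identityʳ (toℕ i)) (K-displacement p)))
signedDistance-K₀ (k _) = K-k

signedDistance-k₀ : ∀ {n} (v : Position (suc n)) → SD (k zero) v (code (Involution.act swap v))
signedDistance-k₀ v = signedDistance-pull swap (signedDistance-K₀ (Involution.act swap v))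

-- Takes `k (fromℕ n)` to `K zero` and keeps left positions left, so `code ∘ turn` measures from `k`
-- at the far end.
turn : ∀ {n} → Position n → Position n
turn v = Involution.act swap (Involution.act reflect v)

signedDistance-kₗ : ∀ {n} (v : Position (suc n)) → SD (k (fromℕ n)) v (code (turn v))
-- `fromℕ n` is `opposite zero` by computation, so reflecting the landmark gives
-- `opposite (opposite zero)`, to be rewritten to `zero`.
signedDistance-kₗ v = signedDistance-pull reflect (subst (λ i → SD (k i) (Involution.act reflect v) (code (turn v)))
  (sym (opposite-involutive zero)) (signedDistance-k₀ (Involution.act reflect v)))

-- Resolving sets

-- A left and a right position that `K zero` and `k (fromℕ n)` fail to separate; of the relation
-- between `j′` and `i` only the inequality is recorded.
Crossed : ∀ {n} → Position n → Position n → Set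
Crossed (Kk i j _) (Kk i′ j′ _) = suc (toℕ j) ≡ toℕ i′ × i <ᶠ j × j′ <ᶠ i
Crossed _          _            = ⊥

pos≢neg : ∀ {a b} → 0 < b → + a ≢ - (+ b)
pos≢neg (s≤s _) ()

depth-opposite-left : ∀ {n} {i j : Fin n} → i <ᶠ j → depth (opposite j) (opposite i) ≡ suc (toℕ (opposite i))
depth-opposite-left {i = i} {j} i<j = depth-left (opposite-< {i = i} {j} i<j)

depth-opposite-right : ∀ {n} {i j : Fin n} → j <ᶠ i → depth (opposite j) (opposite i) ≡ toℕ (opposite j)
depth-opposite-right {i = i} {j} j<i = depth-right (opposite-< {i = j} {i} j<i)

opposite-reflects-≡ : ∀ {n} {i j : Fin n} → toℕ (opposite i) ≡ toℕ (opposite j) → i ≡ j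
opposite-reflects-≡ = opposite-injective ∘ toℕ-injective

opposite-reflects-< : ∀ {n} {i j : Fin n} → opposite i <ᶠ opposite j → j <ᶠ i
opposite-reflects-< {i = i} {j} p =
  subst₂ _<ᶠ_ (opposite-involutive j) (opposite-involutive i) (opposite-< {i = opposite i} {opposite j} p)

-- On the same side, one depth determines the square of one king and the turned depth that of the
-- other. On opposite sides the two equations amount to crossing.
Kk-separates : ∀ {n} {i j i′ j′ : Fin n} .(i≢j : i ≢ j) .(i′≢j′ : i′ ≢ j′) → depth i j ≡ depth i′ j′ →
  depth (opposite j) (opposite i) ≡ depth (opposite j′) (opposite i′) →
  Kk i j i≢j ≡ Kk i′ j′ i′≢j′ ⊎ Crossed (Kk i j i≢j) (Kk i′ j′ i′≢j′) ⊎ Crossed (Kk i′ j′ i′≢j′) (Kk i j i≢j)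
Kk-separates {i = i} {j} {i′} {j′} i≢j i′≢j′ e f with side i j i≢j | side i′ j′ i′≢j′
... | inj₁ l | inj₁ l′
  rewrite depth-left {i = i} {j} l | depth-left {i = i′} {j′} l′
    | depth-opposite-left {i = i} {j} l | depth-opposite-left {i = i′} {j′} l′ =
  inj₁ (Kk-cong (opposite-reflects-≡ (suc-injective f)) (toℕ-injective (suc-injective e)))
... | inj₁ l | inj₂ r′
  rewrite depth-left {i = i} {j} l | depth-right {i = i′} {j′} r′
    | depth-opposite-left {i = i} {j} l | depth-opposite-right {i = i′} {j′} r′ =
  inj₂ (inj₁ (e , l , opposite-reflects-< {i = i} {j′} (≤-reflexive f)))
... | inj₂ r | inj₁ l′
  rewrite depth-right {i = i} {j} r | depth-left {i = i′} {j′} l′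
    | depth-opposite-right {i = i} {j} r | depth-opposite-left {i = i′} {j′} l′ =
  inj₂ (inj₂ (sym e , l′ , opposite-reflects-< {i = i′} {j} (≤-reflexive (sym f))))
... | inj₂ r | inj₂ r′
  rewrite depth-right {i = i} {j} r | depth-right {i = i′} {j′} r′
    | depth-opposite-right {i = i} {j} r | depth-opposite-right {i = i′} {j′} r′ =
  inj₁ (Kk-cong (toℕ-injective e) (opposite-reflects-≡ f))

code-separates : ∀ {n} (v w : Position n) → code v ≡ code w → code (turn v) ≡ code (turn w) →
  v ≡ w ⊎ Crossed v w ⊎ Crossed w v
code-separates (Kk _ _ i≢j) (Kk _ _ i′≢j′) e f = Kk-separates i≢j i′≢j′
  (+ᶻ-injective (neg-injective ([]-injective e))) (+ᶻ-injective (neg-injective ([]-injective f)))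
code-separates (Kk i j i≢j) (K i′) e f = contradiction (sym ([]-injective e)) (pos≢neg (0<depth i≢j))
code-separates (K i) (Kk i′ j′ i′≢j′) e f = contradiction ([]-injective e) (pos≢neg (0<depth i′≢j′))
code-separates (K i) (K i′) e f = inj₁ (cong K (toℕ-injective (+ᶻ-injective ([]-injective e))))
-- Both first codes are `∞`; the square is read off from the turned one.
code-separates (k j) (k j′) e f = inj₁ (cong k (opposite-reflects-≡ (+ᶻ-injective ([]-injective f))))

-- Exchanging the kings exchanges left and right, so the depths seen from `k zero` become `j` and
-- `j + 2`.
code-swap-uncrossed : ∀ {n} (v w : Position n) → Crossed v w →
  code (Involution.act swap v) ≢ code (Involution.act swap w)
code-swap-uncrossed (Kk i j _) (Kk i′ j′ _) (e , i<j , j′<i) f = m≢1+n+m (toℕ j) {1} (begin-equality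
  toℕ j               ≡⟨ depth-right {i = j} {i} i<j ⟨
  depth j i           ≡⟨ +ᶻ-injective (neg-injective ([]-injective f)) ⟩
  depth j′ i′         ≡⟨ depth-left {i = j′} {i′} (<-trans j′<i (<-trans i<j (≤-reflexive e))) ⟩
  suc (toℕ i′)        ≡⟨ cong suc e ⟨
  suc (suc (toℕ j))   ∎)
  where open ≤-Reasoning

-- The squares `j′ < i < j < i′` are four distinct ones.
crossed⇒3<n : ∀ {n} (v w : Position n) → Crossed v w → 3 < n
crossed⇒3<n (Kk i j _) (Kk i′ j′ _) (e , i<j , j′<i) =
  ≤-<-trans (≤-trans (s≤s (≤-trans (s≤s (≤-<-trans z≤n j′<i)) i<j)) (≤-reflexive e)) (toℕ<n i′)

ends-resolve : ∀ {n} → suc n ≤ 3 → IsResolving (kingsGraph (suc n)) (K zero ∷ k (fromℕ n) ∷ [])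
ends-resolve {n} n≤3 = injective⇒resolving codes (λ v → signedDistance-K₀ v ∷ signedDistance-kₗ v ∷ []) codes-injective
  where
  codes : Position (suc n) → Vec (ℤ ⁺) 2
  codes v = code v ∷ code (turn v) ∷ []
  codes-injective : ∀ {v w} → codes v ≡ codes w → v ≡ w
  codes-injective {v} {w} e with code-separates v w (cong head e) (cong (head ∘ tail) e)
  ... | inj₁ v≡w      = v≡w
  ... | inj₂ (inj₁ c) = contradiction n≤3 (<⇒≱ (crossed⇒3<n v w c))
  ... | inj₂ (inj₂ c) = contradiction n≤3 (<⇒≱ (crossed⇒3<n w v c))

ends-and-corner-resolve : ∀ {n} → IsResolving (kingsGraph (suc n)) (K zero ∷ k (fromℕ n) ∷ k zero ∷ [])
ends-and-corner-resolve {n} = injective⇒resolving codes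
  (λ v → signedDistance-K₀ v ∷ signedDistance-kₗ v ∷ signedDistance-k₀ v ∷ []) codes-injective
  where
  codes : Position (suc n) → Vec (ℤ ⁺) 3
  codes v = code v ∷ code (turn v) ∷ code (Involution.act swap v) ∷ []
  codes-injective : ∀ {v w} → codes v ≡ codes w → v ≡ w
  codes-injective {v} {w} e with code-separates v w (cong head e) (cong (head ∘ tail) e)
  ... | inj₁ v≡w      = v≡w
  ... | inj₂ (inj₁ c) = contradiction (cong (head ∘ tail ∘ tail) e) (code-swap-uncrossed v w c)
  ... | inj₂ (inj₂ c) = contradiction (sym (cong (head ∘ tail ∘ tail) e)) (code-swap-uncrossed w v c)

-- Unresolved pairs

-- Every lone `k` is at signed distance `∞` from every lone `K`.
lone-lone : ∀ {n} {i j : Fin (2 + n)} → Tied (K i) (K j)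
lone-lone = k 0F , k 1F , (λ ()) , (∞ , K-k , K-k) , (∞ , K-k , K-k)

-- All right positions are at `∞` from both landmarks, and three squares already admit two of them.
left-left : ∀ {n} {u u′ : Position (3 + n)} → IsLeft u → IsLeft u′ → Tied u u′
left-left l l′ = Kk 1F 0F (λ ()) , Kk 2F 0F (λ ()) , (λ ()) ,
  (∞ , left-right l z<s , left-right l z<s) , (∞ , left-right l′ z<s , left-right l′ z<s)

K-neighbour : ∀ {n} {i j : Fin n} → Adjacent i j → SD (K i) (K j) [ + 1 ]
K-neighbour {i = i} {j} a = neighbour (λ { refl → adjacent-irrefl i a })
  (K-alone a) (K-alone (adjacent-sym {i = i} {j} a))

K-moves-neighbour : ∀ {n} {i i′ j : Fin n} .{p : i ≢ j} .{q : i′ ≢ j} → Adjacent i i′ →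
  SD (Kk i j p) (Kk i′ j q) [ + 1 ]
K-moves-neighbour {i = i} {i′} a = neighbour (λ { refl → adjacent-irrefl i a })
  (K-moves _ _ a) (K-moves _ _ (adjacent-sym {i = i} {i′} a))

k-moves-neighbour : ∀ {n} {i j j′ : Fin n} .{p : i ≢ j} .{q : i ≢ j′} → Adjacent j j′ →
  SD (Kk i j p) (Kk i j′ q) [ + 1 ]
k-moves-neighbour {j = j} {j′} a = neighbour (λ { refl → adjacent-irrefl j a })
  (k-moves _ _ a) (k-moves _ _ (adjacent-sym {i = j} {j′} a))

inject₁-adjacent : ∀ {n} (i : Fin n) → Adjacent (inject₁ i) (suc i)
inject₁-adjacent i = adjacent-up {i = inject₁ i} {suc i} (cong suc (sym (toℕ-inject₁ i)))

data End : ∀ {n} → Fin (2 + n) → Set where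
  first : ∀ {n} → End {n} zero
  last  : ∀ {n} → End (fromℕ (suc n))
  inner : ∀ {n} (i : Fin n) → End (suc (inject₁ i))

view-end : ∀ {n} (i : Fin (2 + n)) → End i
view-end zero = first
view-end (suc i) with view i
... | ‵fromℕ     = last
... | ‵inject₁ i = inner i

-- An inner square has two neighbours, both at distance 1 for `K`, while `k` sees every lone `K` at
-- `∞`.
inner-opposed : ∀ {n} (i : Fin n) (j : Fin (2 + n)) → Tied (K (suc (inject₁ i))) (k j)
inner-opposed i j = K (inject₁ (inject₁ i)) , K (suc (suc i)) , distinct ,
  (_ , K-neighbour (adjacent-sym {i = inject₁ (inject₁ i)} {suc (inject₁ i)} (inject₁-adjacent (inject₁ i))) ,
       K-neighbour {i = suc (inject₁ i)} {suc (suc i)} (inject₁-adjacent (suc i))) ,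
  (∞ , k-K , k-K)
  where
  distinct : K (inject₁ (inject₁ i)) ≢ K (suc (suc i))
  distinct e = m≢1+n+m (toℕ i) {1}
    (trans (sym (trans (toℕ-inject₁ (inject₁ i)) (toℕ-inject₁ i)))
           (cong (λ { (K a) → toℕ a ; _ → 0 }) e))

K₀k₁ K₀k₂ K₁k₂ : ∀ {n} → Position (3 + n)
K₀k₁ = Kk 0F 1F λ ()
K₀k₂ = Kk 0F 2F λ ()
K₁k₂ = Kk 1F 2F λ ()

-- Left positions are all at `∞` from `u`, so two of them at equal distance to `K m` suffice.
right-K : ∀ {n} {u : Position (3 + n)} (m : Fin (3 + n)) → IsRight u → Tied u (K m)
right-K 0F r = K₀k₂ , K₁k₂ , (λ ()) ,
  (∞ , right-left r z<s , right-left r (s≤s z<s)) ,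
  (_ , signedDistance-K₀ K₀k₂ , signedDistance-K₀ K₁k₂)
right-K 1F r = K₀k₂ , K₁k₂ , (λ ()) ,
  (∞ , right-left r z<s , right-left r (s≤s z<s)) ,
  -- Both distances are 2: either k steps next to K and is captured on square 1, or K captures on
  -- square 2 and returns.
  (_ , backward-from-K (finite (cons (k-moves {j′ = 1F} _ (λ ()) refl) (cons (K-captures _ refl) nil) ,
         λ _ p → s≤s⁻¹ (left-capture {i = 0F} {2F} {1F} {i≢j = λ ()} z<s p))) ,
       backward-from-K (finite (cons (K-captures _ refl) (cons (K-alone refl) nil) ,
         λ _ p → s≤s⁻¹ (left-capture {i = 1F} {2F} {1F} {i≢j = λ ()} (s≤s z<s) p))))
right-K (suc (suc m)) r = K₀k₁ , K₀k₂ , (λ ()) ,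
  (∞ , right-left r z<s , right-left r z<s) ,
  -- K captures on its way up to `m`, so both distances equal the displacement `m`.
  (_ , backward-from-K (finite (cons (K-captures _ refl) (K-walk 1F (suc (suc m))) ,
         λ _ p → displacement {i = 0F} {1F} {suc (suc m)} {i≢j = λ ()} p)) ,
       backward-from-K (finite (cons (K-moves {i′ = 1F} _ (λ ()) refl) (cons (K-captures _ refl) (K-walk 2F (suc (suc m)))) ,
         λ _ p → displacement {i = 0F} {2F} {suc (suc m)} {i≢j = λ ()} p)))

-- For left positions the distances to `K zero` and `k zero` depend only on the square of k: here
-- they are 3 and 2.
corner-opposed : ∀ {n} → Tied {3 + n} (K zero) (k zero)
corner-opposed = K₀k₂ , K₁k₂ , (λ ()) ,
  (_ , signedDistance-K₀ K₀k₂ , signedDistance-K₀ K₁k₂) ,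
  (_ , signedDistance-k₀ K₀k₂ , signedDistance-k₀ K₁k₂)

ends-opposed : ∀ {n} → Tied {4 + n} (K zero) (k (fromℕ (3 + n)))
ends-opposed {n} = v , w , (λ ()) ,
  (_ , signedDistance-K₀ v , signedDistance-K₀ w) ,
  (_ , signedDistance-kₗ v , subst (SD _ w) (sym same) (signedDistance-kₗ w))
  where
  v w : Position (4 + n)
  -- The crossed pair on the lowest four squares.
  v = Kk 1F 2F λ ()
  w = Kk 3F 0F λ ()
  same : code (turn v) ≡ code (turn w)
  same = cong (λ d → [ - (+ d) ]) (trans (depth-opposite-left {4 + n} {1F} {2F} (s≤s z<s))
    (trans (sym (opposite-step {4 + n} {0F} {1F} refl)) (sym (depth-opposite-right {4 + n} {3F} {0F} z<s))))

opposed : ∀ {n} (i j : Fin (4 + n)) → Tied (K i) (k j)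
opposed i j with view-end i | view-end j
... | inner a | _       = inner-opposed a j
... | _       | inner b = unresolved-sym (unresolved-pull swap (inner-opposed b i))
... | first   | first   = corner-opposed
... | first   | last    = ends-opposed
... | last    | last    = unresolved-pull reflect
  (subst (λ i → Tied (K i) (k i)) (sym (opposite-involutive 0F)) corner-opposed)
... | last    | first   = unresolved-sym (unresolved-pull swap ends-opposed)

-- From four squares on, every left position has two others at equal distance;
-- with three squares the left positions form a path, and its ends do not.
left₀-right : ∀ {n} {i j : Fin (4 + n)} .{i≢j : i ≢ j} {u} → i ≡ 0F → i <ᶠ j → IsRight u → Tied (Kk i j i≢j) u
-- Here the only two-king neighbour has k on square 2, so the witnesses are taken at distance 2,
-- through it.
left₀-right {j = 1F} refl _ r = Kk 0F 3F (λ ()) , Kk 1F 2F (λ ()) , (λ ()) ,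
  (_ , signedDistance-symmetric
         (distance-two (λ ()) (λ { (k-moves _ _ ()) }) (k-moves {j′ = 2F} _ (λ ()) refl) (k-moves _ _ refl))
         (distance-two (λ ()) (λ { (k-moves _ _ ()) }) (k-moves {j′ = 2F} _ (λ ()) refl) (k-moves _ _ refl)) ,
       signedDistance-symmetric
         (distance-two (λ ()) (λ ()) (k-moves {j′ = 2F} _ (λ ()) refl) (K-moves _ _ refl))
         (distance-two (λ ()) (λ ()) (K-moves {i′ = 0F} _ (λ ()) refl) (k-moves _ _ refl))) ,
  (∞ , right-left r z<s , right-left r (s≤s z<s))
left₀-right {j = suc (suc j)} refl _ r = Kk 0F (suc (inject₁ j)) (λ ()) , Kk 1F (suc (suc j)) (λ ()) , (λ ()) ,
  (_ , k-moves-neighbour (adjacent-sym {i = suc (inject₁ j)} {suc (suc j)} (inject₁-adjacent (suc j))) ,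
       K-moves-neighbour refl) ,
  (∞ , right-left r z<s , right-left r (s≤s z<s))

left-right-tied : ∀ {n} {i j : Fin (4 + n)} .{i≢j : i ≢ j} {u} → i <ᶠ j → IsRight u → Tied (Kk i j i≢j) u
left-right-tied {i = 0F} i<j r = left₀-right refl i<j r
left-right-tied {i = suc i} {j} {u = u} i<j r with view j
-- Both kings have room to step apart: K down or k up gives two left neighbours.
... | ‵inject₁ j′ = Kk (inject₁ i) (inject₁ j′) (<⇒≢ᶠ lower) , Kk (suc i) (suc j′) (<⇒≢ᶠ upper) , distinct ,
  (_ , K-moves-neighbour (adjacent-sym {i = inject₁ i} {suc i} (inject₁-adjacent i)) ,
       k-moves-neighbour (inject₁-adjacent j′)) ,
  (∞ , right-left r lower , right-left r upper)
  where
  lower : inject₁ i <ᶠ inject₁ j′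
  lower = ≤-trans (s≤s (≤-reflexive (toℕ-inject₁ i))) (<⇒≤ i<j)
  upper : suc i <ᶠ suc j′
  upper = m≤n⇒m≤1+n (subst (suc (toℕ i) <_) (toℕ-inject₁ j′) i<j)
  distinct : ∀ .{p q} → Kk (inject₁ i) (inject₁ j′) p ≢ Kk (suc i) (suc j′) q
  distinct e = 1+n≢n (sym (trans (sym (toℕ-inject₁ i)) (cong (λ { (Kk a _ _) → toℕ a ; _ → 0 }) e)))
-- With k on the last square, turning puts K on square 0 and preserves the sides of both positions.
... | ‵fromℕ = unresolved-pull reflect (unresolved-pull swap
  (left₀-right (opposite-involutive 0F) (opposite-< {i = suc i} {opposite 0F} i<j) (turn-right u r)))
  where
  turn-right : ∀ u → IsRight u → IsRight (turn u)
  turn-right (Kk a b _) b<a = opposite-< {i = b} {a} b<a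

Kk-K-tied : ∀ {n} (i j m : Fin (4 + n)) .(i≢j : i ≢ j) → Tied (Kk i j i≢j) (K m)
Kk-K-tied i j m i≢j with side i j i≢j
... | inj₁ i<j = unresolved-pull reflect (right-K (opposite m) (opposite-< {i = i} {j} i<j))
... | inj₂ j<i = right-K m j<i

tied : ∀ {n} (u u′ : Position (4 + n)) → Tied u u′
tied (Kk i j i≢j) (Kk i′ j′ i′≢j′) with side i j i≢j | side i′ j′ i′≢j′
... | inj₁ l | inj₁ l′ = left-left l l′
... | inj₁ l | inj₂ r′ = left-right-tied l r′
... | inj₂ r | inj₁ l′ = unresolved-sym (left-right-tied l′ r)
... | inj₂ r | inj₂ r′ = unresolved-pull swap (left-left r r′)
tied (Kk i j i≢j) (K m)      = Kk-K-tied i j m i≢j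
tied (Kk i j i≢j) (k m)      = unresolved-pull swap (Kk-K-tied j i m (i≢j ∘ sym))
tied (K m) (Kk i j i≢j)      = unresolved-sym (Kk-K-tied i j m i≢j)
tied (k m) (Kk i j i≢j)      = unresolved-sym (unresolved-pull swap (Kk-K-tied j i m (i≢j ∘ sym)))
tied (K _) (K _)             = lone-lone
tied (K i) (k j)             = opposed i j
tied (k j) (K i)             = unresolved-sym (opposed i j)
tied (k _) (k _)             = unresolved-pull swap lone-lone

capture-tied : ∀ {n} {i j : Fin n} .(i≢j : i ≢ j) → Adjacent i j → Tied (Kk i j i≢j) (Kk i j i≢j)
capture-tied {i = i} {j} i≢j a = K j , k i , (λ ()) , confused , confused
  where
  confused : Confuses {kingsGraph _} (Kk i j i≢j) (K j) (k i)
  confused = _ , forward (distance-one (λ ()) (K-captures _ a)) (infinite λ _ → K-not-to-Kk) (_ ≤⊤⁺) ,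
                 forward (distance-one (λ ()) (k-captures _ a)) (infinite λ _ → K-not-to-Kk ∘ walk-push swap) (_ ≤⊤⁺)

tied₂ : (u : Position 2) → Tied u u
tied₂ (Kk 0F 0F i≢j) = ⊥-elim-irr (i≢j refl)
tied₂ (Kk 0F 1F i≢j) = capture-tied i≢j refl
tied₂ (Kk 1F 0F i≢j) = capture-tied i≢j refl
tied₂ (Kk 1F 1F i≢j) = ⊥-elim-irr (i≢j refl)
tied₂ (K _) = lone-lone
tied₂ (k _) = unresolved-pull swap lone-lone

tied₃ : (u : Position 3) → Tied u u
tied₃ (Kk i j i≢j) with side i j i≢j
... | inj₁ l = left-left l l
... | inj₂ r = unresolved-pull swap (left-left r r)
tied₃ (K _) = lone-lone
tied₃ (k _) = unresolved-pull swap lone-lone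

theorem5p6 : ∀ (n : ℕ) →
    (2 ≤ n → n ≤ 3 → IsMetricDimension (kingsGraph n) 2) ×
    (n > 3 → IsMetricDimension (kingsGraph n) 3)
theorem5p6 n = small , large
  where
  small : ∀ {n} → 2 ≤ n → n ≤ 3 → IsMetricDimension (kingsGraph n) 2
  small {2} _ n≤3 = (_ , ((λ ()) ∷ []) ∷ [] ∷ [] , ends-resolve n≤3) ,
    λ _ (S , _ , res) → unresolved⇒2≤ (K 0F) tied₂ S res
  small {3} _ n≤3 = (_ , ((λ ()) ∷ []) ∷ [] ∷ [] , ends-resolve n≤3) ,
    λ _ (S , _ , res) → unresolved⇒2≤ (K 0F) tied₃ S res
  small {suc (suc (suc (suc _)))} _ (s≤s (s≤s (s≤s ())))
  small {1} (s≤s ())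
  large : ∀ {n} → n > 3 → IsMetricDimension (kingsGraph n) 3
  large {suc (suc (suc (suc n)))} _ =
    (_ , ((λ ()) ∷ (λ ()) ∷ []) ∷ ((λ ()) ∷ []) ∷ [] ∷ [] , ends-and-corner-resolve) ,
    λ _ (S , _ , res) → unresolved⇒3≤ (K 0F) tied S res
  large {3} (s≤s (s≤s (s≤s ())))
  large {2} (s≤s (s≤s ()))
  large {1} (s≤s ())
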